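{- For any integer $n\geq 1$, we have \[ |\mathsf{BP}_n^0| = \sum_{i=1}^{p(n)} \frac{n!}{\prod_{j=1}^{d(i)} \left(m(i,j)!\right)^j} = \sum_{i=1}^{p(n)} \prod_{j=1}^{d(i)} \prod_{\ell=1}^{j} \binom{n-\sum_{k=1}^{j-1} k\cdot m(i,k)-(\ell-1)\cdot m(i,j)}{m(i,j)} \] \[ = \sum_{i=1}^{p(n)} \prod_{j=1}^{d(i)} \left( \binom{n-\sum_{k=1}^{j-1} k\cdot m(i,k)}{j\cdot m(i,j)} \cdot \prod_{\ell=1}^{j} \binom{(j-\ell+1)\cdot m(i,j)}{m(i,j)} \right). \]
   Context: Notation: $\llbracket n\rrbracket=\{0,\dots,n-1\}$. A partitioned order of $\llbracket n\rrbracket$ is an (unordered) set $\{S_k\}_{k\in\llbracket s\rrbracket}$ of $s$ sequences $S_k=(i^k_0,\dots,i^k_{n_k-1})$ with $n_k>0$, each consisting of pairwise distinct elements of $\llbracket n\rrbracket$, the sequences being pairwise disjoint (as sets of entries) with union $\llbracket n\rrbracket$; so every element of $\llbracket n\rrbracket$ occurs at exactly one position of exactly one sequence. A block-parallel update mode of size $n$ is a partitioned order of $\llbracket n\rrbracket$; its sequences are called o-blocks. The set of all of them is $\mathsf{BP}_n$. For $\mu=\{S_k\}_{k\in\llbracket s\rrbracket}\in\mathsf{BP}_n$, let $p=\mathrm{lcm}(n_0,\dots,n_{s-1})$ and define the sequence of blocks $\varphi(\mu)=(W_\ell)_{\ell\in\llbracket p\rrbracket}$ by $W_\ell=\{i^k_{\ell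 \bmod n_k}\mid k\in\llbracket s\rrbracket\}$. Equivalence: for $\mu,\mu'\in\mathsf{BP}_n$, $\mu\equiv_0\mu'$ means $\varphi(\mu)=\varphi(\mu')$ (equality of sequences of sets). $\mathsf{BP}_n^0=\mathsf{BP}_n/\equiv_0$ is the quotient set. Integer partitions: $p(n)$ is the number of integer partitions of $n$ (multisets of positive integers summing to $n$), listed in some fixed order as partitions number $1,\dots,p(n)$; $d(i)$ is the maximal part size of the $i$-th partition, and $m(i,j)$ is the multiplicity of the part of size $j$ in the $i$-th partition (possibly $0$). -}

module Defs where

open import Algebra.Structures using (IsCommutativeMonoid)
import Algebra.Properties.CommutativeMonoid.Sum as Sum
open import Data.Fin.Base using (Fin; zero; suc; toℕ)
open import Data.Fin.Subset using (Subset; ⁅_⁆; ⋃)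
open import Data.Fin.Subset.Properties using (∪-isCommutativeMonoid)
open import Data.List.Base as List using (List; []; _∷_; map; upTo; filter)
open import Data.List.Extrema.Nat using (max)
open import Data.List.Membership.Propositional using (_∈_)
open import Data.List.Membership.Propositional.Properties
  using (∈-map⁺; ∈-upTo⁺; ∈-lookup; ∈-cartesianProductWith⁺; ∈-cartesianProductWith⁻; ∈-filter⁺)
open import Data.List.NonEmpty as List⁺ using (List⁺; toList)
open import Data.List.Properties using (∷-injective; map-cong)
open import Data.List.Relation.Binary.Disjoint.Propositional using (Disjoint)
open import Data.List.Relation.Binary.Permutation.Propositional using (_↭_; ↭⇒↭ₛ)
import Data.List.Relation.Binary.Permutation.Propositional.Properties as ↭
import Data.List.Relation.Binary.Permutation.Setoid.Properties as ↭ₛ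
open import Data.List.Relation.Unary.All as All using (All; []; _∷_; all?)
open import Data.List.Relation.Unary.All.Properties using (all-filter)
open import Data.List.Relation.Unary.AllPairs using (AllPairs; []; _∷_)
open import Data.List.Relation.Unary.Any using (Any; here; there; index)
open import Data.List.Relation.Unary.Any.Properties using (lookup-index)
open import Data.List.Relation.Unary.Linked as Linked using (Linked; linked?)
open import Data.List.Relation.Unary.Unique.Propositional using (Unique)
open import Data.List.Relation.Unary.Unique.Propositional.Properties
  using (upTo⁺; cartesianProductWith⁺; filter⁺; map⁺)
open import Data.Nat.Base
open import Data.Nat.DivMod using (_mod_)
open import Data.Nat.Divisibility using (∣-trans; ∣-antisym; ∣-refl; 1∣_)
open import Data.Nat.LCM using (lcm; lcm-comm; lcm-least; m∣lcm[m,n]; n∣lcm[m,n])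
open import Data.Nat.ListAction using (sum)
open import Data.Nat.Properties
open import Data.Product.Base using (_×_; _,_)
open import Data.Rational.Base using (ℚ)
import Data.Rational.Properties as ℚ
open import Function.Base using (_on_; _∘_)
open import Function.Bundles using (Bijection; _⤖_; mk⤖)
open import Function.Definitions using (Injective)
open import Level using (0ℓ)
open import Relation.Binary.Bundles using (Setoid)
import Relation.Binary.Construct.On as On
open import Relation.Binary.PropositionalEquality
open import Relation.Nullary.Decidable.Core using (_×-dec_)
open import Relation.Nullary.Negation.Core using (contradiction)
open import Relation.Unary using (Decidable)

private
  variable
    n : ℕ

HasCardinality : Setoid 0ℓ 0ℓ → ℕ → Set
HasCardinality S N = Bijection S (setoid (Fin N))

module ℕ-∑ = Sum +-0-commutativeMonoid
module ℕ-∏ = Sum *-1-commutativeMonoid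
module ℚ-∑ = Sum ℚ.+-0-commutativeMonoid

infixr 5 ∑< ∑ℚ< ∑₁ ∏₁

∑< : ∀ N → (Fin N → ℕ) → ℕ
∑< N = ℕ-∑.sum

∑ℚ< : ∀ N → (Fin N → ℚ) → ℚ
∑ℚ< N = ℚ-∑.sum

-- ∑₁ b f = f 1 + … + f b and ∏₁ b f = f 1 * … * f b

∑₁ : ℕ → (ℕ → ℕ) → ℕ
∑₁ b f = ℕ-∑.sum {b} (f ∘ suc ∘ toℕ)

∏₁ : ℕ → (ℕ → ℕ) → ℕ
∏₁ b f = ℕ-∏.sum {b} (f ∘ suc ∘ toℕ)

syntax ∑<  N (λ i → e) = ∑[ i < N ] e
syntax ∑ℚ< N (λ i → e) = ∑ℚ[ i < N ] e
syntax ∑₁  b (λ k → e) = ∑[ k =1… b ] e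
syntax ∏₁  b (λ k → e) = ∏[ k =1… b ] e

∏₁-nonZero : ∀ b {f : ℕ → ℕ} → (∀ k → NonZero (f k)) → NonZero (∏₁ b f)
∏₁-nonZero zero    f≢0 = _
∏₁-nonZero (suc b) f≢0 =
  m*n≢0 _ _ {{f≢0 1}} {{∏₁-nonZero b (λ k → f≢0 (suc k))}}

-- The set of o-blocks is given by a list, without repetition since o-blocks
-- are nonempty and disjoint.  The order of the list does not affect φ (see
-- φ-resp-↭), hence it disappears in the quotient by ≡₀.
record BP (n : ℕ) : Set where
  field
    blocks   : List (List⁺ (Fin n))
    distinct : All (Unique ∘ toList) blocks
    disjoint : AllPairs (Disjoint on toList) blocks
    covering : ∀ i → Any (λ S → i ∈ toList S) blocks

open BP public

period : List (List⁺ (Fin n)) → ℕ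
period Ss = List.foldr lcm 1 (map List⁺.length Ss)

at : ℕ → List⁺ (Fin n) → Fin n
at ℓ S = List.lookup (toList S) (ℓ mod List⁺.length S)

W : List (List⁺ (Fin n)) → ℕ → Subset n
W Ss ℓ = ⋃ (map (λ S → ⁅ at ℓ S ⁆) Ss)

φ : BP n → List (Subset n)
φ μ = map (W (blocks μ)) (upTo (period (blocks μ)))

_≡₀_ : BP n → BP n → Set
μ ≡₀ μ′ = φ μ ≡ φ μ′

BP⁰ : ℕ → Setoid 0ℓ 0ℓ
BP⁰ n = record
  { Carrier       = BP n
  ; _≈_           = _≡₀_
  ; isEquivalence = On.isEquivalence φ isEquivalence
  }

private
  lcm-assoc : ∀ a b c → lcm (lcm a b) c ≡ lcm a (lcm b c)
  lcm-assoc a b c = ∣-antisym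
    (lcm-least
      (lcm-least (m∣lcm[m,n] a _) (∣-trans (m∣lcm[m,n] b c) (n∣lcm[m,n] a _)))
      (∣-trans (n∣lcm[m,n] b c) (n∣lcm[m,n] a _)))
    (lcm-least
      (∣-trans (m∣lcm[m,n] a b) (m∣lcm[m,n] (lcm a b) c))
      (lcm-least (∣-trans (n∣lcm[m,n] a b) (m∣lcm[m,n] (lcm a b) c)) (n∣lcm[m,n] (lcm a b) c)))

  lcm-identityˡ : ∀ a → lcm 1 a ≡ a
  lcm-identityˡ a = ∣-antisym (lcm-least (1∣ a) ∣-refl) (n∣lcm[m,n] 1 a)

  lcm-identityʳ : ∀ a → lcm a 1 ≡ a
  lcm-identityʳ a = trans (lcm-comm a 1) (lcm-identityˡ a)

  lcm-1-isCommutativeMonoid : IsCommutativeMonoid _≡_ lcm 1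
  lcm-1-isCommutativeMonoid = record
    { isMonoid = record
      { isSemigroup = record
        { isMagma = record { isEquivalence = isEquivalence ; ∙-cong = cong₂ lcm }
        ; assoc   = lcm-assoc
        }
      ; identity = lcm-identityˡ , lcm-identityʳ
      }
    ; comm = lcm-comm
    }

φ-resp-↭ : (μ μ′ : BP n) → blocks μ ↭ blocks μ′ → μ ≡₀ μ′
φ-resp-↭ {n} μ μ′ p = trans
  (map-cong W-eq (upTo (period (blocks μ))))
  (cong (map (W (blocks μ′)) ∘ upTo) period-eq)
  where
  period-eq : period (blocks μ) ≡ period (blocks μ′)
  period-eq = ↭ₛ.foldr-commMonoid (setoid ℕ) lcm-1-isCommutativeMonoid
                (↭⇒↭ₛ (↭.map⁺ List⁺.length p))

  W-eq : ∀ ℓ → W (blocks μ) ℓ ≡ W (blocks μ′) ℓ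
  W-eq ℓ = ↭ₛ.foldr-commMonoid (setoid (Subset n)) (∪-isCommutativeMonoid n)
             (↭⇒↭ₛ (↭.map⁺ (λ S → ⁅ at ℓ S ⁆) p))

-- A multiset is represented by its non-increasing list of elements.
record Partition (n : ℕ) : Set where
  constructor mkPartition
  field
    parts         : List ℕ
    nonincreasing : Linked _≥_ parts
    positive      : All (0 <_) parts
    sum≡n         : sum parts ≡ n

open Partition public

parts-injective : {π π′ : Partition n} → parts π ≡ parts π′ → π ≡ π′
parts-injective {π = mkPartition xs a b c} {mkPartition _ a′ b′ c′} refl
  with refl ← Linked.irrelevant ≤-irrelevant a a′
     | refl ← All.irrelevant ≤-irrelevant b b′
     | refl ← ≡-irrelevant c c′ = refl

private
  IsPartition : ℕ → List ℕ → Set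
  IsPartition n xs = Linked _≥_ xs × All (0 <_) xs × sum xs ≡ n

  isPartition? : ∀ n → Decidable (IsPartition n)
  isPartition? n xs =
    linked? _≥?_ xs ×-dec all? (0 <?_) xs ×-dec (sum xs ≟ n)

  -- words b l lists the words over {1,…,b} of length at most l.
  words : ℕ → ℕ → List (List ℕ)
  words b zero    = [] ∷ []
  words b (suc l) =
    [] ∷ List.cartesianProductWith _∷_ (map suc (upTo b)) (words b l)

  words-unique : ∀ b l → Unique (words b l)
  words-unique b zero    = [] ∷ []
  words-unique b (suc l) =
    All.tabulate (λ w∈ []≡w → []∉ (subst (_∈ _) (sym []≡w) w∈)) ∷
    cartesianProductWith⁺ _∷_ ∷-injective
      (map⁺ suc-injective (upTo⁺ b)) (words-unique b l)
    where
    []∉ : [] ∈ List.cartesianProductWith _∷_ (map suc (upTo b)) (words b l) → _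
    []∉ []∈ with ∈-cartesianProductWith⁻ _∷_ (map suc (upTo b)) (words b l) []∈
    ... | _ , _ , _ , _ , ()

  ∈-words : ∀ b l xs → All (0 <_) xs → sum xs ≤ b → sum xs ≤ l →
            xs ∈ words b l
  ∈-words b zero    []           _            _   _   = here refl
  ∈-words b (suc l) []           _            _   _   = here refl
  ∈-words b zero    (suc _ ∷ _)  (_ ∷ _)      _   ()
  ∈-words _ _       (zero ∷ _)   (() ∷ _)     _   _
  ∈-words b (suc l) (suc x ∷ xs) (_ ∷ 0<xs)   s≤b s≤l = there
    (∈-cartesianProductWith⁺ _∷_
      (∈-map⁺ suc (∈-upTo⁺ (m+n≤o⇒m≤o (suc x) s≤b)))
      (∈-words b l xs 0<xs (m+n≤o⇒n≤o (suc x) s≤b)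
        (m+n≤o⇒n≤o x (s≤s⁻¹ s≤l))))

  listing : ℕ → List (List ℕ)
  listing n = filter (isPartition? n) (words n n)

  lookup-injective : {xs : List (List ℕ)} → Unique xs →
                     Injective _≡_ _≡_ (List.lookup xs)
  lookup-injective (_ ∷ _)     {zero}  {zero}  _  = refl
  lookup-injective (x∉ ∷ _)    {zero}  {suc j} eq =
    contradiction eq (All.lookup x∉ (∈-lookup j))
  lookup-injective (x∉ ∷ _)    {suc i} {zero}  eq =
    contradiction (sym eq) (All.lookup x∉ (∈-lookup i))
  lookup-injective (_ ∷ xs!)   {suc i} {suc j} eq =
    cong suc (lookup-injective xs! eq)

p : ℕ → ℕ
p n = List.length (listing n)

partition : ∀ n → Fin (p n) → Partition n
partition n i =
  let a , b , c = All.lookup (all-filter (isPartition? n) (words n n)) (∈-lookup i)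
  in mkPartition (List.lookup (listing n) i) a b c

-- Every partition of n is listed exactly once.
partition-bijection : ∀ n → Fin (p n) ⤖ Partition n
partition-bijection n = mk⤖ {to = partition n} (injective , surjective)
  where
  injective : Injective _≡_ _≡_ (partition n)
  injective eq = lookup-injective
    (filter⁺ (isPartition? n) (words-unique n n)) (cong parts eq)

  surjective : ∀ π → _
  surjective π@(mkPartition xs a b c) =
    index xs∈ , λ { refl → parts-injective (sym (lookup-index xs∈)) }
    where
    xs∈ : xs ∈ listing n
    xs∈ = ∈-filter⁺ (isPartition? n)
      (∈-words n n xs b (≤-reflexive c) (≤-reflexive c)) (a , b , c)

d : ∀ n → Fin (p n) → ℕ
d n i = max 0 (parts (partition n i))

m : ∀ n → Fin (p n) → ℕ → ℕ
m n i j = List.length (filter (j ≟_) (parts (partition n i)))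

m!^≢0 : ∀ n i j → NonZero ((m n i j !) ^ j)
m!^≢0 n i j = m^n≢0 (m n i j !) j {{m n i j !≢0}}

{-# OPTIONS --safe #-}

-- Colour i by the pair (j , q) if i is the entry number q of an o-block of size j.
-- Then i ∈ W_ℓ iff ℓ mod j = q, and as j divides the period, φ(μ) determines the
-- colours and is determined by them.  So the classes of ≡₀ are the colourings in
-- which the colours (j , 0), …, (j , j − 1) occur equally often, say m_j times, for
-- each j.  Here j occurs m_j times in some partition of n, and the colourings
-- belonging to a given partition are the arrangements of a multiset, counted by a
-- multinomial coefficient.  Choosing the entries of one colour after the other
-- turns it into a product of binomials.

module Submission where

open import Defs
open import Data.Empty using (⊥)
open import Data.Fin.Base using (Fin; toℕ; zero; suc)
open import Data.Fin.Properties using (toℕ-fromℕ<; toℕ-injective; toℕ<n)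
open import Data.Fin.Subset using (⁅_⁆) renaming (_∈_ to _∈ˢ_)
open import Data.Fin.Subset.Properties using (∉⊥; x∈⁅x⁆; x∈⁅y⁆⇒x≡y; x∈p∪q⁺; x∈p∪q⁻; ⊆-antisym)
open import Data.Integer.Base as ℤ using (+_)
import Data.Integer.Properties as ℤ
open import Data.List.Base hiding (sum; product; find; partition)
open import Data.List.Extrema.Nat using (xs≤max)
open import Data.List.Membership.Propositional using (_∈_; find; lose)
open import Data.List.Membership.Propositional.Properties
open import Data.List.Membership.Propositional.Properties.WithK using (unique∧set⇒bag)
open import Data.List.NonEmpty.Base as List⁺ using (List⁺; toList)
open import Data.List.Properties hiding (≡-dec)
open import Data.List.Relation.Binary.BagAndSetEquality using (∼bag⇒↭)
open import Data.List.Relation.Binary.Disjoint.Propositional using (Disjoint)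
open import Data.List.Relation.Binary.Permutation.Propositional
  using (_↭_; ↭-refl; ↭-sym; ↭-trans; ↭-reflexive; prep; swap; ↭⇒↭ₛ; module PermutationReasoning)
import Data.List.Relation.Binary.Permutation.Propositional as ↭
open import Data.List.Relation.Binary.Permutation.Propositional.Properties hiding (map⁺; sum-↭)
import Data.List.Relation.Binary.Permutation.Propositional.Properties as ↭
import Data.List.Relation.Binary.Permutation.Setoid.Properties as ↭ₛ
open import Data.List.Relation.Binary.Pointwise using (Pointwise-≡⇒≡)
open import Data.List.Relation.Unary.All as All using (All; []; _∷_)
import Data.List.Relation.Unary.All.Properties as All
open import Data.List.Relation.Unary.AllPairs as AllPairs using (AllPairs; []; _∷_)
import Data.List.Relation.Unary.AllPairs.Properties as AllPairs
open import Data.List.Relation.Unary.Any as Any using (Any; here; there)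
open import Data.List.Relation.Unary.Any.Properties using (lookup-index)
open import Data.List.Relation.Unary.Sorted.TotalOrder.Properties using (↗↭↗⇒≋)
open import Data.List.Relation.Unary.Unique.Propositional using (Unique)
open import Data.List.Relation.Unary.Unique.Propositional.Properties as Unique
  using (map⁺; concat⁺; allFin⁺; applyUpTo⁺₁)
import Data.List.Sort as Sort
open import Data.Nat.Base as ℕ hiding (_/_)
open import Data.Nat.Combinatorics
open import Data.Nat.Combinatorics.Specification using (k>n⇒nCk≡0)
open import Data.Nat.Divisibility
open import Data.Nat.DivMod hiding (_/_)
open import Data.Nat.GCD using (gcd)
open import Data.Nat.LCM
open import Data.Nat.ListAction using (sum; product)
open import Data.Nat.ListAction.Properties using (product-++; sum-↭)
open import Data.Nat.Properties
open import Data.Nat.Solver using (module +-*-Solver)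
open import Data.Product.Base using (∃; ∃₂; _×_; _,_; proj₁; proj₂)
open import Data.Product.Properties using (≡-dec; ,-injective)
open import Data.Rational.Base as ℚ using (_/_)
import Data.Rational.Properties as ℚ
open import Data.Rational.Unnormalised.Base as ℚᵘ using (mkℚᵘ; *≡*)
import Data.Rational.Unnormalised.Properties as ℚᵘ
open import Data.Sum.Base using (inj₁; inj₂)
open import Function.Base using (_∘_; id; _on_)
open import Function.Bundles using (Bijection; mk⇔)
open import Level using (0ℓ)
open import Relation.Binary.Bundles using (Setoid)
open import Relation.Binary.Definitions using (DecidableEquality)
open import Relation.Binary.Properties.DecTotalOrder ≤-decTotalOrder
  using (≥-decTotalOrder; ≥-totalOrder)
open import Relation.Binary.PropositionalEquality
open import Relation.Nullary.Decidable.Core using (yes; no; ¬?)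
open import Relation.Nullary.Negation.Core using (contradiction)
open +-*-Solver using (solve; _:*_; _:=_)

-- Arrangements of a multiset

-- A colouring `f` is handled as the list `tabulate f`, so that all conditions on how often colours
-- occur become one permutation statement, `u ↭ concatMap positions ps`, with `ps` the block sizes.
-- Necessity is read off the blocks of a mode. Sufficiency is constructive: a permutation of colours
-- lifts to a permutation of the indices, which is then cut into blocks. Counting is enumeration:
-- the admissible colourings are listed without repetition, and the length of the list is the
-- cardinality. All three formulas are reached from one normal form,
-- `binomials n (multiplicities d m)`; for the quotient of factorials this is done by multiplying
-- out, never by dividing.

concatMap-↭ : ∀ {A B : Set} (f : A → List B) {xs ys} → xs ↭ ys → concatMap f xs ↭ concatMap f ys
concatMap-↭ f ↭.refl         = ↭-refl
concatMap-↭ f (prep x p)     = ++⁺ˡ (f x) (concatMap-↭ f p)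
concatMap-↭ f (swap x y p)   =
  ↭-trans (shifts (f x) (f y)) (++⁺ˡ (f y) (++⁺ˡ (f x) (concatMap-↭ f p)))
concatMap-↭ f (↭.trans p q)  = ↭-trans (concatMap-↭ f p) (concatMap-↭ f q)

-- The multinomial coefficient `r! / (m1! ... mk! (r - m1 - ... - mk)!)`, written as successive
-- choices; it is 0 if the `m`s add up to more than `r`.
binomials : ℕ → List ℕ → ℕ
binomials r []       = 1
binomials r (m ∷ ms) = (r C m) * binomials (r ∸ m) ms

module _ {A : Set} where

  -- The shuffles of `m` equal letters with `w`, split by their first letter. For the lengths, this
  -- split is Pascal's rule.
  insertions : A → ℕ → List A → List (List A)
  insertions a zero    w       = w ∷ []
  insertions a (suc m) []      = map (a ∷_) (insertions a m [])
  insertions a (suc m) (x ∷ w) =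
    map (a ∷_) (insertions a m (x ∷ w)) ++ map (x ∷_) (insertions a (suc m) w)

  arrangements : List (A × ℕ) → List (List A)
  arrangements []             = [] ∷ []
  arrangements ((a , m) ∷ cs) = concatMap (insertions a m) (arrangements cs)

  expand : List (A × ℕ) → List A
  expand = concatMap (λ (a , m) → replicate m a)

  length-expand : ∀ cs → length (expand cs) ≡ sum (map proj₂ cs)
  length-expand []             = refl
  length-expand ((a , m) ∷ cs) = trans (length-++ (replicate m a))
    (cong₂ _+_ (length-replicate m) (length-expand cs))

  length-insertions : ∀ a m w → length (insertions a m w) ≡ (m + length w) C m
  length-insertions a zero    w       = refl
  length-insertions a (suc m) []      = begin
    length (map (a ∷_) (insertions a m [])) ≡⟨ length-map (a ∷_) (insertions a m []) ⟩
    length (insertions a m [])              ≡⟨ length-insertions a m [] ⟩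
    (m + 0) C m                             ≡⟨ cong (_C m) (+-identityʳ m) ⟩
    m C m                                   ≡⟨ nCn≡1 m ⟩
    1                                       ≡⟨ nCn≡1 (suc m) ⟨
    suc m C suc m                           ≡⟨ cong (_C suc m) (+-identityʳ (suc m)) ⟨
    (suc m + 0) C suc m                     ∎
    where open ≡-Reasoning
  length-insertions a (suc m) (x ∷ w) = begin
    length (map (a ∷_) u ++ map (x ∷_) v)
      ≡⟨ length-++ (map (a ∷_) u) ⟩
    length (map (a ∷_) u) + length (map (x ∷_) v)
      ≡⟨ cong₂ _+_ (length-map (a ∷_) u) (length-map (x ∷_) v) ⟩
    length u + length v
      ≡⟨ cong₂ _+_ (length-insertions a m (x ∷ w)) (length-insertions a (suc m) w) ⟩
    (m + suc (length w)) C m + suc (m + length w) C suc m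
      ≡⟨ cong (λ k → (m + suc (length w)) C m + k C suc m) (+-suc m (length w)) ⟨
    (m + suc (length w)) C m + (m + suc (length w)) C suc m
      ≡⟨ nCk+nC[k+1]≡[n+1]C[k+1] (m + suc (length w)) m ⟩
    suc (m + suc (length w)) C suc m ∎
    where
    open ≡-Reasoning
    u = insertions a m (x ∷ w)
    v = insertions a (suc m) w

  insertions-↭ : ∀ a m w {u} → u ∈ insertions a m w → u ↭ replicate m a ++ w
  insertions-↭ a zero    w       (here refl) = ↭-refl
  insertions-↭ a (suc m) []      u∈ with ∈-map⁻ (a ∷_) u∈
  ... | v , v∈ , refl = prep a (insertions-↭ a m [] v∈)
  insertions-↭ a (suc m) (x ∷ w) u∈ with ∈-++⁻ (map (a ∷_) (insertions a m (x ∷ w))) u∈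
  ... | inj₁ u∈ˡ with v , v∈ , refl ← ∈-map⁻ (a ∷_) u∈ˡ = prep a (insertions-↭ a m (x ∷ w) v∈)
  ... | inj₂ u∈ʳ with v , v∈ , refl ← ∈-map⁻ (x ∷_) u∈ʳ =
    ↭-trans (prep x (insertions-↭ a (suc m) w v∈)) (↭-sym (shift x (replicate (suc m) a) w))

  arrangements-↭ : ∀ cs {u} → u ∈ arrangements cs → u ↭ expand cs
  arrangements-↭ []             (here refl) = ↭-refl
  arrangements-↭ ((a , m) ∷ cs) u∈
    with v , v∈ , u∈v ← find (∈-concatMap⁻ (insertions a m) {xs = arrangements cs} u∈) =
    ↭-trans (insertions-↭ a m v u∈v) (++⁺ˡ (replicate m a) (arrangements-↭ cs v∈))

  length-arrangements : ∀ cs → length (arrangements cs) ≡ binomials (sum (map proj₂ cs)) (map proj₂ cs)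
  length-arrangements []             = refl
  length-arrangements ((a , m) ∷ cs) = begin
    length (concatMap (insertions a m) (arrangements cs))
      ≡⟨ go (arrangements cs) (λ u∈ → trans (↭-length (arrangements-↭ cs u∈)) (length-expand cs)) ⟩
    ((m + s) C m) * length (arrangements cs)
      ≡⟨ cong (((m + s) C m) *_) (length-arrangements cs) ⟩
    ((m + s) C m) * binomials s (map proj₂ cs)
      ≡⟨ cong (λ r → ((m + s) C m) * binomials r (map proj₂ cs)) (m+n∸m≡n m s) ⟨
    ((m + s) C m) * binomials (m + s ∸ m) (map proj₂ cs) ∎
    where
    open ≡-Reasoning
    s = sum (map proj₂ cs)
    go : ∀ ws → (∀ {w} → w ∈ ws → length w ≡ s) →
         length (concatMap (insertions a m) ws) ≡ ((m + s) C m) * length ws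
    go []       |w|≡s = sym (*-zeroʳ ((m + s) C m))
    go (w ∷ ws) |w|≡s = begin
      length (insertions a m w ++ concatMap (insertions a m) ws)
        ≡⟨ length-++ (insertions a m w) ⟩
      length (insertions a m w) + length (concatMap (insertions a m) ws)
        ≡⟨ cong₂ _+_ (trans (length-insertions a m w) (cong (λ k → (m + k) C m) (|w|≡s (here refl))))
             (go ws (|w|≡s ∘ there)) ⟩
      (m + s) C m + ((m + s) C m) * length ws
        ≡⟨ *-suc ((m + s) C m) (length ws) ⟨
      ((m + s) C m) * suc (length ws) ∎

  -- Two readings of one rectangle, by columns and by rows; `go` peels off a row. It turns `m`
  -- occurrences of each colour of size `j` into `m` blocks of size `j`.
  expand-constant : ∀ m xs → expand (map (_, m) xs) ↭ concat (replicate m xs)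
  expand-constant zero    []       = ↭-refl
  expand-constant zero    (x ∷ xs) = expand-constant zero xs
  expand-constant (suc m) xs       =
    ↭-trans (go xs) (++⁺ˡ xs (expand-constant m xs))
    where
    go : ∀ xs → expand (map (_, suc m) xs) ↭ xs ++ expand (map (_, m) xs)
    go []       = ↭-refl
    go (x ∷ xs) = prep x (↭-trans (++⁺ˡ (replicate m x) (go xs))
      (shifts (replicate m x) xs))

  map-∷-disjoint : ∀ {x y : A} {us vs : List (List A)} → x ≢ y → Disjoint (map (x ∷_) us) (map (y ∷_) vs)
  map-∷-disjoint x≢y (u∈ , v∈)
    with _ , _ , refl ← ∈-map⁻ (_ ∷_) u∈ | _ , _ , refl ← ∈-map⁻ (_ ∷_) v∈ = x≢y refl

  -- Since `a` is not in `w`, the two halves of the recursion differ in the first letter.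
  insertions-unique : ∀ a m w → All (a ≢_) w → Unique (insertions a m w)
  insertions-unique a zero    w       a∉w         = [] ∷ []
  insertions-unique a (suc m) []      a∉w         = map⁺ ∷-injectiveʳ (insertions-unique a m [] a∉w)
  insertions-unique a (suc m) (x ∷ w) (a≢x ∷ a∉w) = Unique.++⁺
    (map⁺ ∷-injectiveʳ (insertions-unique a m (x ∷ w) (a≢x ∷ a∉w)))
    (map⁺ ∷-injectiveʳ (insertions-unique a (suc m) w a∉w))
    (map-∷-disjoint a≢x)

  ∈-insertions-∷ : ∀ {a} m {u} w → u ∈ insertions a m w → a ∷ u ∈ insertions a (suc m) w
  ∈-insertions-∷ m []      u∈ = ∈-map⁺ (_ ∷_) u∈
  ∈-insertions-∷ m (x ∷ w) u∈ = ∈-++⁺ˡ (∈-map⁺ (_ ∷_) u∈)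

  ∈-insertions-∷′ : ∀ {a x} m {u w} → u ∈ insertions a m w → x ∷ u ∈ insertions a m (x ∷ w)
  ∈-insertions-∷′ zero    (here refl) = here refl
  ∈-insertions-∷′ (suc m) u∈          = ∈-++⁺ʳ (map (_ ∷_) (insertions _ m _)) (∈-map⁺ (_ ∷_) u∈)

  module _ (_≟_ : DecidableEquality A) where

    count : A → List A → ℕ
    count a xs = length (filter (a ≟_) xs)

    remove : A → List A → List A
    remove a = filter (¬? ∘ (a ≟_))

    ∈-insertions : ∀ a u → u ∈ insertions a (count a u) (remove a u)
    ∈-insertions a []      = here refl
    ∈-insertions a (x ∷ u) with a ≟ x
    ... | yes refl = ∈-insertions-∷ (count a u) (remove a u) (∈-insertions a u)
    ... | no _     = ∈-insertions-∷′ (count a u) (∈-insertions a u)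

    ↭-count-remove : ∀ a xs → xs ↭ replicate (count a xs) a ++ remove a xs
    ↭-count-remove a xs = insertions-↭ a _ (remove a xs) (∈-insertions a xs)

    remove-all : ∀ {a xs} → All (a ≢_) xs → remove a xs ≡ xs
    remove-all = filter-all (¬? ∘ (_ ≟_))

    count-none : ∀ {a xs} → All (a ≢_) xs → count a xs ≡ 0
    count-none a∉ = cong length (filter-none (_ ≟_) a∉)

    -- Deleting `a` undoes the insertion, so different `w` give disjoint lists of insertions; this
    -- is what `arrangements-unique` rests on.
    remove-insertions : ∀ {a} m {w u} → All (a ≢_) w → u ∈ insertions a m w → remove a u ≡ w
    remove-insertions {a} zero    a∉w (here refl) = remove-all a∉w
    remove-insertions {a} (suc m) {[]} a∉w u∈ with ∈-map⁻ (a ∷_) u∈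
    ... | v , v∈ , refl =
      trans (filter-reject (¬? ∘ (a ≟_)) (λ a≢a → a≢a refl)) (remove-insertions m a∉w v∈)
    remove-insertions {a} (suc m) {x ∷ w} (a≢x ∷ a∉w) u∈
      with ∈-++⁻ (map (a ∷_) (insertions a m (x ∷ w))) u∈
    ... | inj₁ u∈ˡ with v , v∈ , refl ← ∈-map⁻ (a ∷_) u∈ˡ =
      trans (filter-reject (¬? ∘ (a ≟_)) (λ a≢a → a≢a refl)) (remove-insertions m (a≢x ∷ a∉w) v∈)
    ... | inj₂ u∈ʳ with v , v∈ , refl ← ∈-map⁻ (x ∷_) u∈ʳ =
      trans (filter-accept (¬? ∘ (a ≟_)) a≢x) (cong (x ∷_) (remove-insertions (suc m) a∉w v∈))

    expand-avoids : ∀ {a} cs → All (a ≢_) (map proj₁ cs) → All (a ≢_) (expand cs)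
    expand-avoids []             []           = []
    expand-avoids ((b , m) ∷ cs) (a≢b ∷ a∉cs) =
      All.++⁺ (All.replicate⁺ m a≢b) (expand-avoids cs a∉cs)

    arrangements-avoid : ∀ {a} cs → All (a ≢_) (map proj₁ cs) →
      ∀ {u} → u ∈ arrangements cs → All (a ≢_) u
    arrangements-avoid cs a∉cs u∈ = All-resp-↭ (↭-sym (arrangements-↭ cs u∈)) (expand-avoids cs a∉cs)

    arrangements-unique : ∀ cs → Unique (map proj₁ cs) → Unique (arrangements cs)
    arrangements-unique []             []           = [] ∷ []
    arrangements-unique ((a , m) ∷ cs) (a∉cs ∷ cs!) =
      go (arrangements cs) (arrangements-avoid cs a∉cs) (arrangements-unique cs cs!)
      where
      go : ∀ ws → (∀ {w} → w ∈ ws → All (a ≢_) w) → Unique ws → Unique (concatMap (insertions a m) ws)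
      go []       a∉ws []           = []
      go (w ∷ ws) a∉ws (w∉ws ∷ ws!) = Unique.++⁺
        (insertions-unique a m w (a∉ws (here refl)))
        (go ws (a∉ws ∘ there) ws!)
        λ (u∈ˡ , u∈ʳ) →
          let v , v∈ , u∈v = find (∈-concatMap⁻ (insertions a m) {xs = ws} u∈ʳ)
          in All.lookup w∉ws v∈ (trans
               (sym (remove-insertions m (a∉ws (here refl)) u∈ˡ))
               (remove-insertions m (a∉ws (there v∈)) u∈v))

    count-replicate-++ : ∀ a m {ys} → All (a ≢_) ys → count a (replicate m a ++ ys) ≡ m
    count-replicate-++ a zero    a∉ys = count-none a∉ys
    count-replicate-++ a (suc m) a∉ys = trans
      (cong length (filter-accept (a ≟_) refl)) (cong suc (count-replicate-++ a m a∉ys))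

    remove-replicate-++ : ∀ a m {ys} → All (a ≢_) ys → remove a (replicate m a ++ ys) ≡ ys
    remove-replicate-++ a zero    a∉ys = remove-all a∉ys
    remove-replicate-++ a (suc m) a∉ys = trans
      (filter-reject (¬? ∘ (a ≟_)) (λ a≢a → a≢a refl)) (remove-replicate-++ a m a∉ys)

    -- Converse of `arrangements-↭`. Filtering respects permutations, so the number of `a`s in `u`
    -- and the rest of `u` can be computed on `expand`, where they are `m` and a permutation of the
    -- remaining expansion.
    ∈-arrangements : ∀ cs {u} → Unique (map proj₁ cs) → u ↭ expand cs → u ∈ arrangements cs
    ∈-arrangements []             []           u↭ with refl ← ↭-empty-inv u↭ = here refl
    ∈-arrangements ((a , m) ∷ cs) {u} (a∉cs ∷ cs!) u↭ =
      ∈-concatMap⁺ (insertions a m) {xs = arrangements cs} (lose rest∈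
        (subst (λ k → u ∈ insertions a k (remove a u)) count≡m (∈-insertions a u)))
      where
      a∉ = expand-avoids cs a∉cs
      count≡m : count a u ≡ m
      count≡m = trans (↭-length (filter-↭ (a ≟_) u↭)) (count-replicate-++ a m a∉)
      rest∈ : remove a u ∈ arrangements cs
      rest∈ = ∈-arrangements cs cs!
        (↭-trans (filter-↭ (¬? ∘ (a ≟_)) u↭) (↭-reflexive (remove-replicate-++ a m a∉)))

    count-remove : ∀ {a b} xs → a ≢ b → count b (remove a xs) ≡ count b xs
    count-remove         []       a≢b = refl
    count-remove {a} {b} (x ∷ xs) a≢b with a ≟ x
    ... | yes refl = trans (count-remove xs a≢b)
      (sym (cong length (filter-reject (b ≟_) {xs = xs} (a≢b ∘ sym))))
    ... | no _ with b ≟ x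
    ...   | yes _ = cong suc (count-remove xs a≢b)
    ...   | no _  = count-remove xs a≢b

    -- Splitting off the copies of `a` leaves the counts of the other letters unchanged, so the
    -- induction runs along `as`. For the parts of a partition this is its notation by
    -- multiplicities.
    ↭-expand-counts : ∀ as xs → Unique as → All (_∈ as) xs → xs ↭ expand (map (λ a → a , count a xs) as)
    ↭-expand-counts []       []       []           xs⊆ = ↭-refl
    ↭-expand-counts []       (x ∷ xs) []           (() ∷ _)
    ↭-expand-counts (a ∷ as) xs       (a∉as ∷ as!) xs⊆ = begin
      xs
        ↭⟨ ↭-count-remove a xs ⟩
      replicate (count a xs) a ++ remove a xs
        ↭⟨ ++⁺ˡ _ (↭-expand-counts as (remove a xs) as! rest⊆) ⟩
      replicate (count a xs) a ++ expand (map (λ b → b , count b (remove a xs)) as)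
        ≡⟨ cong (λ cs → replicate (count a xs) a ++ expand cs)
             (map-cong-local (All.map (λ a≢b → cong (_ ,_) (count-remove xs a≢b)) a∉as)) ⟩
      replicate (count a xs) a ++ expand (map (λ b → b , count b xs) as) ∎
      where
      open PermutationReasoning
      rest⊆ : All (_∈ as) (remove a xs)
      rest⊆ = All.zipWith (λ (a≢x , x∈) → Any.tail (a≢x ∘ sym) x∈)
        (All.all-filter (¬? ∘ (a ≟_)) xs , All.filter⁺ (¬? ∘ (a ≟_)) xs⊆)

-- Products of binomials

binomials-++ : ∀ r ms ns → binomials r (ms ++ ns) ≡ binomials r ms * binomials (r ∸ sum ms) ns
binomials-++ r []       ns = sym (*-identityˡ _)
binomials-++ r (m ∷ ms) ns = begin
  (r C m) * binomials (r ∸ m) (ms ++ ns)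
    ≡⟨ cong ((r C m) *_) (binomials-++ (r ∸ m) ms ns) ⟩
  (r C m) * (binomials (r ∸ m) ms * binomials (r ∸ m ∸ sum ms) ns)
    ≡⟨ *-assoc (r C m) _ _ ⟨
  binomials r (m ∷ ms) * binomials (r ∸ m ∸ sum ms) ns
    ≡⟨ cong (λ k → binomials r (m ∷ ms) * binomials k ns) (∸-+-assoc r m (sum ms)) ⟩
  binomials r (m ∷ ms) * binomials (r ∸ (m + sum ms)) ns ∎
  where open ≡-Reasoning

-- Each group of choices starts from what the earlier groups left over; this produces the outer
-- product over `j` in both binomial formulas.
binomials-concat : ∀ (f : ℕ → List ℕ) d r →
  binomials r (concat (applyUpTo f d)) ≡
  ℕ-∏.sum {d} (λ j → binomials (r ∸ ℕ-∑.sum {toℕ j} (sum ∘ f ∘ toℕ)) (f (toℕ j)))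
binomials-concat f zero    r = refl
binomials-concat f (suc d) r = begin
  binomials r (f 0 ++ concat (applyUpTo (f ∘ suc) d))
    ≡⟨ binomials-++ r (f 0) _ ⟩
  binomials r (f 0) * binomials (r ∸ sum (f 0)) (concat (applyUpTo (f ∘ suc) d))
    ≡⟨ cong (binomials r (f 0) *_) (binomials-concat (f ∘ suc) d (r ∸ sum (f 0))) ⟩
  binomials r (f 0) * ℕ-∏.sum {d} (λ j →
    binomials (r ∸ sum (f 0) ∸ ℕ-∑.sum {toℕ j} (sum ∘ f ∘ suc ∘ toℕ)) (f (suc (toℕ j))))
    ≡⟨ cong (binomials r (f 0) *_) (ℕ-∏.sum-cong-≗ {d} λ j →
         cong (λ k → binomials k (f (suc (toℕ j)))) (∸-+-assoc r (sum (f 0)) _)) ⟩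
  ℕ-∏.sum {suc d} (λ j → binomials (r ∸ ℕ-∑.sum {toℕ j} (sum ∘ f ∘ toℕ)) (f (toℕ j))) ∎
  where open ≡-Reasoning

binomials-replicate : ∀ j m r →
  binomials r (replicate j m) ≡ ∏[ ℓ =1… j ] (r ∸ (ℓ ∸ 1) * m) C m
binomials-replicate zero    m r = refl
binomials-replicate (suc j) m r = cong ((r C m) *_) (trans
  (binomials-replicate j m (r ∸ m))
  (ℕ-∏.sum-cong-≗ {j} λ i → cong (_C m) (∸-+-assoc r m (toℕ i * m))))

sum-replicate : ∀ j m → sum (replicate j m) ≡ j * m
sum-replicate zero    m = refl
sum-replicate (suc j) m = cong (λ k → m + k) (sum-replicate j m)

binomials-replicate-sum : ∀ j m →
  binomials (j * m) (replicate j m) ≡ ∏[ ℓ =1… j ] ((j ∸ ℓ + 1) * m) C m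
binomials-replicate-sum zero    m = refl
binomials-replicate-sum (suc j) m = cong₂ _*_
  -- The factor for `ℓ = 1` contains `suc j ∸ 1 + 1`, which computes to `j + 1` and not to `suc j`.
  (cong (λ k → (k * m) C m) (sym (+-comm j 1)))
  (trans (cong (λ k → binomials k (replicate j m)) (m+n∸m≡n m (j * m)))
    (binomials-replicate-sum j m))

C-factorial : ∀ a b → ((a + b) C a) * (a ! * b !) ≡ (a + b) !
C-factorial a b = begin
  ((a + b) C a) * (a ! * b !)
    ≡⟨ cong (λ k → ((a + b) C a) * (a ! * k !)) (m+n∸m≡n a b) ⟨
  ((a + b) C a) * (a ! * (a + b ∸ a) !)
    ≡⟨ cong (_* (a ! * (a + b ∸ a) !)) (nCk≡n!/k![n-k]! (m≤m+n a b)) ⟩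
  ((a + b) ! ℕ./ (a ! * (a + b ∸ a) !)) * (a ! * (a + b ∸ a) !)
    ≡⟨ m/n*n≡m (k![n∸k]!∣n! (m≤m+n a b)) ⟩
  (a + b) ! ∎
  where
  open ≡-Reasoning
  instance _ = a !* (a + b ∸ a) !≢0

-- Choosing `m` and then `s` more is choosing `m + s` and then `m` among these. If `r = m + s + t`,
-- both sides become `r !` after multiplication by `m ! * (s ! * t !)`. Otherwise both vanish: on
-- the left, either `m` exceeds `r` or `s` exceeds `r ∸ m`.
C-trinomial : ∀ r m s → (r C m) * ((r ∸ m) C s) ≡ (r C (m + s)) * ((m + s) C m)
C-trinomial r m s with m + s ≤? r
... | yes m+s≤r with t , refl ← m≤n⇒∃[o]m+o≡n m+s≤r = *-cancelʳ-≡ _ _ (m ! * (s ! * t !)) {{nz}} (begin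
  ((m + s + t) C m) * ((m + s + t ∸ m) C s) * (m ! * (s ! * t !))
    ≡⟨ cong (λ k → (k C m) * ((k ∸ m) C s) * (m ! * (s ! * t !))) (+-assoc m s t) ⟩
  ((m + (s + t)) C m) * ((m + (s + t) ∸ m) C s) * (m ! * (s ! * t !))
    ≡⟨ cong (λ k → ((m + (s + t)) C m) * (k C s) * (m ! * (s ! * t !))) (m+n∸m≡n m (s + t)) ⟩
  ((m + (s + t)) C m) * ((s + t) C s) * (m ! * (s ! * t !))
    ≡⟨ solve 4 (λ x y z w → x :* y :* (z :* w) := x :* (z :* (y :* w))) refl
         ((m + (s + t)) C m) ((s + t) C s) (m !) (s ! * t !) ⟩
  ((m + (s + t)) C m) * (m ! * (((s + t) C s) * (s ! * t !)))
    ≡⟨ cong (λ k → ((m + (s + t)) C m) * (m ! * k)) (C-factorial s t) ⟩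
  ((m + (s + t)) C m) * (m ! * (s + t) !)
    ≡⟨ C-factorial m (s + t) ⟩
  (m + (s + t)) !
    ≡⟨ cong _! (+-assoc m s t) ⟨
  (m + s + t) !
    ≡⟨ C-factorial (m + s) t ⟨
  ((m + s + t) C (m + s)) * ((m + s) ! * t !)
    ≡⟨ cong (λ k → ((m + s + t) C (m + s)) * (k * t !)) (C-factorial m s) ⟨
  ((m + s + t) C (m + s)) * (((m + s) C m) * (m ! * s !) * t !)
    ≡⟨ solve 5 (λ x y z w v → x :* (y :* (z :* w) :* v) := x :* y :* (z :* (w :* v))) refl
         ((m + s + t) C (m + s)) ((m + s) C m) (m !) (s !) (t !) ⟩
  ((m + s + t) C (m + s)) * ((m + s) C m) * (m ! * (s ! * t !)) ∎)
  where
  open ≡-Reasoning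
  nz = m*n≢0 (m !) (s ! * t !) {{m !≢0}} {{s !* t !≢0}}
... | no m+s≰r = trans left (sym (cong (_* ((m + s) C m)) (k>n⇒nCk≡0 (≰⇒> m+s≰r))))
  where
  left : (r C m) * ((r ∸ m) C s) ≡ 0
  left with m ≤? r
  ... | yes m≤r = trans (cong ((r C m) *_) (k>n⇒nCk≡0 (≰⇒> λ s≤ →
    m+s≰r (subst (_≤ r) (+-comm s m) (m≤o∸n⇒m+n≤o s m≤r s≤))))) (*-zeroʳ (r C m))
  ... | no m≰r  = cong (_* ((r ∸ m) C s)) (k>n⇒nCk≡0 (≰⇒> m≰r))

-- Reserve the places for all of `ms` at once, then distribute them. Applied to the equal
-- multiplicities of one part size, this leads to the third formula.
binomials-sum : ∀ r ms → binomials r ms ≡ (r C sum ms) * binomials (sum ms) ms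
binomials-sum r []       = refl
binomials-sum r (m ∷ ms) = begin
  (r C m) * binomials (r ∸ m) ms
    ≡⟨ cong ((r C m) *_) (binomials-sum (r ∸ m) ms) ⟩
  (r C m) * (((r ∸ m) C s) * binomials s ms)
    ≡⟨ *-assoc (r C m) _ _ ⟨
  (r C m) * ((r ∸ m) C s) * binomials s ms
    ≡⟨ cong (_* binomials s ms) (C-trinomial r m s) ⟩
  (r C (m + s)) * ((m + s) C m) * binomials s ms
    ≡⟨ *-assoc (r C (m + s)) _ _ ⟩
  (r C (m + s)) * (((m + s) C m) * binomials s ms)
    ≡⟨ cong (λ k → (r C (m + s)) * (((m + s) C m) * binomials k ms)) (m+n∸m≡n m s) ⟨
  (r C (m + s)) * (((m + s) C m) * binomials (m + s ∸ m) ms) ∎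
  where
  open ≡-Reasoning
  s = sum ms

-- The multinomial formula with denominators cleared: each binomial turns the factorials of the two
-- parts into the factorial of their sum.
binomials-factorial : ∀ ms → binomials (sum ms) ms * product (map _! ms) ≡ (sum ms) !
binomials-factorial []       = refl
binomials-factorial (m ∷ ms) = begin
  ((m + s) C m) * binomials (m + s ∸ m) ms * (m ! * product (map _! ms))
    ≡⟨ cong (λ k → ((m + s) C m) * binomials k ms * (m ! * product (map _! ms))) (m+n∸m≡n m s) ⟩
  ((m + s) C m) * binomials s ms * (m ! * product (map _! ms))
    ≡⟨ solve 4 (λ x y z w → x :* y :* (z :* w) := x :* (z :* (y :* w))) refl
         ((m + s) C m) (binomials s ms) (m !) (product (map _! ms)) ⟩
  ((m + s) C m) * (m ! * (binomials s ms * product (map _! ms)))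
    ≡⟨ cong (λ k → ((m + s) C m) * (m ! * k)) (binomials-factorial ms) ⟩
  ((m + s) C m) * (m ! * s !)
    ≡⟨ C-factorial m s ⟩
  (m + s) ! ∎
  where
  open ≡-Reasoning
  s = sum ms

product-!-concat : ∀ (f : ℕ → List ℕ) d →
  product (map _! (concat (applyUpTo f d))) ≡ ℕ-∏.sum {d} (product ∘ map _! ∘ f ∘ toℕ)
product-!-concat f zero    = refl
product-!-concat f (suc d) = begin
  product (map _! (f 0 ++ rest))              ≡⟨ cong product (map-++ _! (f 0) rest) ⟩
  product (map _! (f 0) ++ map _! rest)       ≡⟨ product-++ (map _! (f 0)) (map _! rest) ⟩
  product (map _! (f 0)) * product (map _! rest)
    ≡⟨ cong (product (map _! (f 0)) *_) (product-!-concat (f ∘ suc) d) ⟩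
  ℕ-∏.sum {suc d} (product ∘ map _! ∘ f ∘ toℕ) ∎
  where
  open ≡-Reasoning
  rest = concat (applyUpTo (f ∘ suc) d)

product-!-replicate : ∀ j m → product (map _! (replicate j m)) ≡ (m !) ^ j
product-!-replicate zero    m = refl
product-!-replicate (suc j) m = cong (m ! *_) (product-!-replicate j m)

-- One entry per colour: the `j` colours of size `j` all occur `m j` times. The order of the list is
-- the order of the factors in the second formula.
multiplicities : ℕ → (ℕ → ℕ) → List ℕ
multiplicities d m = concat (applyUpTo (λ k → replicate (suc k) (m (suc k))) d)

module _ (d : ℕ) (m : ℕ → ℕ) (r : ℕ) where

  private
    remaining : ∀ (j : Fin d) →
      r ∸ ℕ-∑.sum {toℕ j} (λ k → sum (replicate (suc (toℕ k)) (m (suc (toℕ k))))) ≡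
      r ∸ (∑[ k =1… toℕ j ] k * m k)
    remaining j = cong (r ∸_) (ℕ-∑.sum-cong-≗ {toℕ j} λ k → sum-replicate (suc (toℕ k)) (m (suc (toℕ k))))

  binomials-multiplicities : binomials r (multiplicities d m) ≡
    ∏[ j =1… d ] ∏[ ℓ =1… j ] (r ∸ (∑[ k =1… j ∸ 1 ] k * m k) ∸ (ℓ ∸ 1) * m j) C (m j)
  binomials-multiplicities = trans (binomials-concat _ d r) (ℕ-∏.sum-cong-≗ {d} λ j →
    trans (cong (λ k → binomials k (replicate (suc (toℕ j)) (m (suc (toℕ j))))) (remaining j))
      (binomials-replicate (suc (toℕ j)) (m (suc (toℕ j))) _))

  binomials-multiplicities′ : binomials r (multiplicities d m) ≡
    ∏[ j =1… d ] ((r ∸ (∑[ k =1… j ∸ 1 ] k * m k)) C (j * m j))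
      * (∏[ ℓ =1… j ] ((j ∸ ℓ + 1) * m j) C (m j))
  binomials-multiplicities′ = trans (binomials-concat _ d r) (ℕ-∏.sum-cong-≗ {d} λ j →
    let j′ = suc (toℕ j) ; mj = m j′ ; R = r ∸ (∑[ k =1… toℕ j ] k * m k) in
    begin
      _                                      ≡⟨ cong (λ k → binomials k (replicate j′ mj)) (remaining j) ⟩
      binomials R (replicate j′ mj)          ≡⟨ binomials-sum R (replicate j′ mj) ⟩
      (R C sum (replicate j′ mj)) * binomials (sum (replicate j′ mj)) (replicate j′ mj)
        ≡⟨ cong (λ k → (R C k) * binomials k (replicate j′ mj)) (sum-replicate j′ mj) ⟩
      (R C (j′ * mj)) * binomials (j′ * mj) (replicate j′ mj)
        ≡⟨ cong ((R C (j′ * mj)) *_) (binomials-replicate-sum j′ mj) ⟩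
      _ ∎)
    where open ≡-Reasoning

product-!-multiplicities : ∀ d m → product (map _! (multiplicities d m)) ≡ ∏[ j =1… d ] (m j !) ^ j
product-!-multiplicities d m = trans (product-!-concat _ d)
  (ℕ-∏.sum-cong-≗ {d} λ j → product-!-replicate (suc (toℕ j)) (m (suc (toℕ j))))

-- Natural numbers as rationals

/1-homo-+ : ∀ a b → + (a + b) / 1 ≡ (+ a / 1) ℚ.+ (+ b / 1)
-- Normalisation by a gcd blocks computation in the rationals; as unnormalised fractions all terms
-- have denominator 1, and the equation is one between integers.
/1-homo-+ a b = ℚ.toℚᵘ-injective (begin
  ℚ.toℚᵘ (+ (a + b) / 1)
    ≈⟨ ℚ.toℚᵘ-fromℚᵘ (mkℚᵘ (+ (a + b)) 0) ⟩
  mkℚᵘ (+ (a + b)) 0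
    ≈⟨ *≡* (cong (ℤ._* (+ 1)) (cong₂ ℤ._+_ (ℤ.*-identityʳ (+ a)) (ℤ.*-identityʳ (+ b)))) ⟨
  mkℚᵘ (+ a) 0 ℚᵘ.+ mkℚᵘ (+ b) 0
    ≈⟨ ℚᵘ.+-cong (ℚ.toℚᵘ-fromℚᵘ (mkℚᵘ (+ a) 0)) (ℚ.toℚᵘ-fromℚᵘ (mkℚᵘ (+ b) 0)) ⟨
  ℚ.toℚᵘ (+ a / 1) ℚᵘ.+ ℚ.toℚᵘ (+ b / 1)
    ≈⟨ ℚ.toℚᵘ-homo-+ (+ a / 1) (+ b / 1) ⟨
  ℚ.toℚᵘ ((+ a / 1) ℚ.+ (+ b / 1)) ∎)
  where open ℚᵘ.≃-Reasoning

/1-homo-∑ : ∀ N (a : Fin N → ℕ) → + (∑< N a) / 1 ≡ ∑ℚ< N (λ i → + a i / 1)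
/1-homo-∑ zero    a = refl
/1-homo-∑ (suc N) a = trans (/1-homo-+ (a zero) _)
  (cong ((+ a zero / 1) ℚ.+_) (/1-homo-∑ N (a ∘ suc)))

/1-quotient : ∀ a b c .{{_ : NonZero b}} → a * b ≡ c → + a / 1 ≡ + c / b
/1-quotient a (suc b) c eq = ℚ.fromℚᵘ-cong {mkℚᵘ (+ a) 0} {mkℚᵘ (+ c) b}
  (*≡* (trans (sym (ℤ.pos-* a (suc b))) (trans (cong +_ eq) (sym (ℤ.*-identityʳ (+ c))))))

-- Colourings of a given shape

Colour : Set
Colour = ℕ × ℕ

_≟ᶜ_ : DecidableEquality Colour
_≟ᶜ_ = ≡-dec _≟_ _≟_

positions : ℕ → List Colour
positions j = applyUpTo (j ,_) j

slots : ℕ → (ℕ → ℕ) → List (Colour × ℕ)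
slots d m = concatMap (λ j → map (_, m j) (positions j)) (applyUpTo suc d)

slots-multiplicities : ∀ d m → map proj₂ (slots d m) ≡ multiplicities d m
slots-multiplicities d m = begin
  map proj₂ (concatMap f (applyUpTo suc d))            ≡⟨ concat-map (map f (applyUpTo suc d)) ⟨
  concat (map (map proj₂) (map f (applyUpTo suc d)))   ≡⟨ cong concat (map-∘ (applyUpTo suc d)) ⟨
  concat (map (map proj₂ ∘ f) (applyUpTo suc d))       ≡⟨ cong concat (map-cong const (applyUpTo suc d)) ⟩
  concat (map (λ j → replicate j (m j)) (applyUpTo suc d))
    ≡⟨ cong concat (map-applyUpTo suc (λ j → replicate j (m j)) d) ⟩
  multiplicities d m ∎
  where
  open ≡-Reasoning
  f : ℕ → List (Colour × ℕ)
  f j = map (_, m j) (positions j)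
  go : ∀ (g : ℕ → Colour) k (x : ℕ) → map proj₂ (map (_, x) (applyUpTo g k)) ≡ replicate k x
  go g zero    x = refl
  go g (suc k) x = cong (x ∷_) (go (g ∘ suc) k x)
  const : ∀ j → map proj₂ (f j) ≡ replicate j (m j)
  const j = go (j ,_) j (m j)

slots-colours : ∀ d m → map proj₁ (slots d m) ≡ concatMap positions (applyUpTo suc d)
slots-colours d m = begin
  map proj₁ (concatMap f (applyUpTo suc d))            ≡⟨ concat-map (map f (applyUpTo suc d)) ⟨
  concat (map (map proj₁) (map f (applyUpTo suc d)))   ≡⟨ cong concat (map-∘ (applyUpTo suc d)) ⟨
  concat (map (map proj₁ ∘ f) (applyUpTo suc d))
    ≡⟨ cong concat (map-cong (λ j → trans (sym (map-∘ (positions j))) (map-id (positions j)))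
         (applyUpTo suc d)) ⟩
  concatMap positions (applyUpTo suc d) ∎
  where
  open ≡-Reasoning
  f : ℕ → List (Colour × ℕ)
  f j = map (_, m j) (positions j)

slots-unique : ∀ d m → Unique (map proj₁ (slots d m))
slots-unique d m = subst Unique (sym (slots-colours d m)) (concat⁺
  (All.map⁺ (All.universal unique-positions (applyUpTo suc d)))
  (AllPairs.map⁺ (AllPairs.map disjoint-positions
    (applyUpTo⁺₁ suc d λ i<j _ → <⇒≢ i<j ∘ suc-injective))))
  where
  unique-positions : ∀ j → Unique (positions j)
  unique-positions j = applyUpTo⁺₁ (j ,_) j λ i<j _ → <⇒≢ i<j ∘ proj₂ ∘ ,-injective
  disjoint-positions : ∀ {j k} → j ≢ k → Disjoint (positions j) (positions k)
  disjoint-positions j≢k (c∈ , c∈′)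
    with _ , _ , refl ← ∈-applyUpTo⁻ (_ ,_) c∈ | _ , _ , eq ← ∈-applyUpTo⁻ (_ ,_) c∈′ =
    j≢k (proj₁ (,-injective eq))

-- The same colours grouped in two ways: by colour, as needed for counting, and by block, as they
-- come from a mode.
expand-slots : ∀ d m →
  expand (slots d m) ↭ concatMap positions (expand (map (λ j → j , m j) (applyUpTo suc d)))
expand-slots d m = go (applyUpTo suc d)
  where
  open PermutationReasoning
  go : ∀ js → expand (concatMap (λ j → map (_, m j) (positions j)) js) ↭
              concatMap positions (expand (map (λ j → j , m j) js))
  go []       = ↭-refl
  go (j ∷ js) = begin
    expand (map (_, m j) (positions j) ++ concatMap (λ j → map (_, m j) (positions j)) js)
      ≡⟨ concatMap-++ _ (map (_, m j) (positions j)) _ ⟩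
    expand (map (_, m j) (positions j)) ++ expand (concatMap (λ j → map (_, m j) (positions j)) js)
      ↭⟨ ++⁺ (expand-constant (m j) (positions j)) (go js) ⟩
    concat (replicate (m j) (positions j)) ++ concatMap positions (expand (map (λ j → j , m j) js))
      ≡⟨ cong (λ xss → concat xss ++ concatMap positions (expand (map (λ j → j , m j) js)))
           (map-replicate positions (m j) j) ⟨
    concatMap positions (replicate (m j) j) ++ concatMap positions (expand (map (λ j → j , m j) js))
      ≡⟨ concatMap-++ positions (replicate (m j) j) _ ⟨
    concatMap positions (replicate (m j) j ++ expand (map (λ j → j , m j) js)) ∎

parts-↭ : ∀ n i → parts (partition n i) ↭ expand (map (λ j → j , m n i j) (applyUpTo suc (d n i)))
parts-↭ n i = ↭-expand-counts _≟_ (applyUpTo suc (d n i)) ps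
  (applyUpTo⁺₁ suc (d n i) λ i<j _ → <⇒≢ i<j ∘ suc-injective)
  (All.zipWith (λ {x} → in-range {x}) (positive (partition n i) , xs≤max 0 ps))
  where
  ps = parts (partition n i)
  in-range : ∀ {x} → 0 < x × x ≤ d n i → x ∈ applyUpTo suc (d n i)
  in-range {suc x} (_ , x<d) = ∈-applyUpTo⁺ suc x<d

slots-↭ : ∀ n i → expand (slots (d n i) (m n i)) ↭ concatMap positions (parts (partition n i))
slots-↭ n i = ↭-trans (expand-slots (d n i) (m n i)) (concatMap-↭ positions (↭-sym (parts-↭ n i)))

-- The colour (j , 0) occurs once for each block of size j.
firsts : Colour → List ℕ
firsts (j , zero)  = j ∷ []
firsts (j , suc _) = []

firsts-positions : ∀ ps → All (0 <_) ps → concatMap firsts (concatMap positions ps) ≡ ps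
firsts-positions []           []        = refl
firsts-positions (suc j ∷ ps) (_ ∷ 0<ps) = cong (suc j ∷_) (begin
  concatMap firsts (applyUpTo (λ q → suc j , suc q) j ++ concatMap positions ps)
    ≡⟨ concatMap-++ firsts (applyUpTo (λ q → suc j , suc q) j) _ ⟩
  concatMap firsts (applyUpTo (λ q → suc j , suc q) j) ++ concatMap firsts (concatMap positions ps)
    ≡⟨ cong₂ _++_ (go j id) (firsts-positions ps 0<ps) ⟩
  ps ∎)
  where
  open ≡-Reasoning
  go : ∀ k (g : ℕ → ℕ) → concatMap firsts (applyUpTo (λ q → suc j , suc (g q)) k) ≡ []
  go zero    g = refl
  go (suc k) g = go k (g ∘ suc)

-- Keeping only the colours `(j , 0)` recovers the parts up to order, and two sorted lists that are
-- permutations of each other are equal.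
positions-injective : ∀ {n} (π ρ : Partition n) →
  concatMap positions (parts π) ↭ concatMap positions (parts ρ) → π ≡ ρ
positions-injective π ρ p = parts-injective (Pointwise-≡⇒≡
  (↗↭↗⇒≋ ≥-totalOrder (nonincreasing π) (nonincreasing ρ) (↭⇒↭ₛ parts↭)))
  where
  parts↭ : parts π ↭ parts ρ
  parts↭ = subst₂ _↭_ (firsts-positions (parts π) (positive π)) (firsts-positions (parts ρ) (positive ρ))
    (concatMap-↭ firsts p)

lookup-injective : ∀ {A : Set} {xs : List A} → Unique xs → ∀ i j → lookup xs i ≡ lookup xs j → i ≡ j
lookup-injective (_ ∷ _)    zero    zero    eq = refl
lookup-injective (x∉ ∷ _)   zero    (suc j) eq = contradiction eq (All.lookup x∉ (∈-lookup j))
lookup-injective (x∉ ∷ _)   (suc i) zero    eq = contradiction (sym eq) (All.lookup x∉ (∈-lookup i))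
lookup-injective (_ ∷ xs!)  (suc i) (suc j) eq = cong suc (lookup-injective xs! i j eq)

-- Equal lists have equal lengths, so `φ μ` retains the period besides the blocks `W`.
applyUpTo-injective : ∀ {A : Set} {f g : ℕ → A} a b → applyUpTo f a ≡ applyUpTo g b →
  a ≡ b × (∀ {i} → i < a → f i ≡ g i)
applyUpTo-injective zero    zero    eq = refl , λ ()
applyUpTo-injective {f = f} {g} (suc a) (suc b) eq
  with f0≡g0 , rest ← ∷-injective eq
  with a≡b , f≡g ← applyUpTo-injective a b rest =
  cong suc a≡b , λ { {zero} _ → f0≡g0 ; {suc i} (s≤s i<a) → f≡g i<a }

tabulate-injective : ∀ {A : Set} {n} {f g : Fin n → A} → tabulate f ≡ tabulate g → f ≗ g
tabulate-injective eq zero    = ∷-injectiveˡ eq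
tabulate-injective eq (suc i) = tabulate-injective (∷-injectiveʳ eq) i

-- The colouring of a block-parallel mode

map≡applyUpTo⁻ : ∀ {A B : Set} {f : A → B} g xs → map f xs ≡ applyUpTo g (length xs) →
  ∀ k → f (lookup xs k) ≡ g (toℕ k)
map≡applyUpTo⁻ g (x ∷ xs) eq zero    = ∷-injectiveˡ eq
map≡applyUpTo⁻ g (x ∷ xs) eq (suc k) = map≡applyUpTo⁻ (g ∘ suc) xs (∷-injectiveʳ eq) k

map≡applyUpTo⁺ : ∀ {A B : Set} {f : A → B} g xs → (∀ k → f (lookup xs k) ≡ g (toℕ k)) →
  map f xs ≡ applyUpTo g (length xs)
map≡applyUpTo⁺ g []       eq = refl
map≡applyUpTo⁺ g (x ∷ xs) eq = cong₂ _∷_ (eq zero) (map≡applyUpTo⁺ (g ∘ suc) xs (eq ∘ suc))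

map-++⁻ : ∀ {A B : Set} (f : A → B) xs as {bs} → map f xs ≡ as ++ bs →
  ∃₂ λ ys zs → xs ≡ ys ++ zs × map f ys ≡ as × map f zs ≡ bs
map-++⁻ f xs       []       eq = [] , xs , refl , refl , eq
map-++⁻ f (x ∷ xs) (a ∷ as) eq
  with fx≡a , rest ← ∷-injective eq
  with ys , zs , refl , refl , refl ← map-++⁻ f xs as rest =
  x ∷ ys , zs , refl , cong (_∷ _) fx≡a , refl

Unique-++⁻ : ∀ {A : Set} (xs : List A) {ys} → Unique (xs ++ ys) → Unique xs × Unique ys × Disjoint xs ys
Unique-++⁻ []       ys!        = [] , ys! , λ ()
Unique-++⁻ (x ∷ xs) (x∉ ∷ xs++ys!)
  with xs! , ys! , xs#ys ← Unique-++⁻ xs xs++ys! =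
  All.++⁻ˡ xs x∉ ∷ xs! , ys! , λ where
    (here refl , v∈ys) → All.lookup (All.++⁻ʳ xs x∉) v∈ys refl
    (there v∈  , v∈ys) → xs#ys (v∈ , v∈ys)

module _ {n : ℕ} where

  -- Stated for an arbitrary `f`, so that it serves both for the colouring computed from a mode and
  -- for a prescribed colouring that a mode has to realise.
  Fits : (Fin n → Colour) → List⁺ (Fin n) → Set
  Fits f S = ∀ k → f (lookup (toList S) k) ≡ (List⁺.length S , toℕ k)

  Located : List (List⁺ (Fin n)) → Fin n → Set
  Located Ss i = ∃ λ S → S ∈ Ss × ∃ λ k → lookup (toList S) k ≡ i

  locate : ∀ {Ss i} → Any (λ S → i ∈ toList S) Ss → Located Ss i
  locate i∈ = let S , S∈ , i∈S = find i∈ in S , S∈ , Any.index i∈S , sym (lookup-index i∈S)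

  fits-unique : ∀ {f g Ss} → All (Fits f) Ss → All (Fits g) Ss → (∀ i → Located Ss i) → f ≗ g
  fits-unique fitsᶠ fitsᵍ located i with _ , S∈ , k , refl ← located i =
    trans (All.lookup fitsᶠ S∈ k) (sym (All.lookup fitsᵍ S∈ k))

  at-∈W : ∀ ℓ {S} {Ss : List (List⁺ (Fin n))} → S ∈ Ss → at ℓ S ∈ˢ W Ss ℓ
  at-∈W ℓ {S} (here refl) = x∈p∪q⁺ (inj₁ (x∈⁅x⁆ (at ℓ S)))
  at-∈W ℓ     (there S∈)  = x∈p∪q⁺ (inj₂ (at-∈W ℓ S∈))

  ∈W⇒at : ∀ ℓ (Ss : List (List⁺ (Fin n))) {i} → i ∈ˢ W Ss ℓ → ∃ λ S → S ∈ Ss × i ≡ at ℓ S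
  ∈W⇒at ℓ []       i∈ = contradiction i∈ ∉⊥
  ∈W⇒at ℓ (S ∷ Ss) i∈ with x∈p∪q⁻ ⁅ at ℓ S ⁆ (W Ss ℓ) i∈
  ... | inj₁ i∈S = S , here refl , x∈⁅y⁆⇒x≡y (at ℓ S) i∈S
  ... | inj₂ i∈W with T , T∈ , eq ← ∈W⇒at ℓ Ss i∈W = T , there T∈ , eq

  ∈⇒∣period : ∀ {S : List⁺ (Fin n)} {Ss} → S ∈ Ss → List⁺.length S ∣ period Ss
  ∈⇒∣period {Ss = T ∷ Ss} (here refl) = m∣lcm[m,n] (List⁺.length T) (period Ss)
  ∈⇒∣period {Ss = T ∷ Ss} (there S∈)  = ∣-trans (∈⇒∣period S∈) (n∣lcm[m,n] (List⁺.length T) (period Ss))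

  period-least : ∀ {p} (Ss : List (List⁺ (Fin n))) → (∀ {S} → S ∈ Ss → List⁺.length S ∣ p) → period Ss ∣ p
  period-least []       h = 1∣ _
  period-least (S ∷ Ss) h = lcm-least (h (here refl)) (period-least Ss (h ∘ there))

  -- A vanishing lcm would make `gcd a b * lcm a b`, that is `a * b`, vanish.
  period≢0 : ∀ (Ss : List (List⁺ (Fin n))) → NonZero (period Ss)
  period≢0 []       = _
  period≢0 (S ∷ Ss) = m*n≢0⇒n≢0 (gcd a b)
    {{subst NonZero (sym (gcd*lcm a b)) (m*n≢0 a b {{_}} {{period≢0 Ss}})}}
    where
    a = List⁺.length S
    b = period Ss

-- The condition ℓ ≡ q modulo j for a colour (j , q); no block has size 0.
Hits : Colour → ℕ → Set
Hits (zero  , q) ℓ = ⊥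
Hits (suc j , q) ℓ = ℓ % suc j ≡ q

-- Membership in `W` as a congruence

module _ {n : ℕ} {f : Fin n → Colour} {Ss : List (List⁺ (Fin n))} (fits : All (Fits f) Ss) where

  ∈W⇒Hits : ∀ ℓ {i} → i ∈ˢ W Ss ℓ → Hits (f i) ℓ
  ∈W⇒Hits ℓ i∈ with S , S∈ , refl ← ∈W⇒at ℓ Ss i∈ =
    subst (λ c → Hits c ℓ) (sym (All.lookup fits S∈ (ℓ mod List⁺.length S)))
      (sym (toℕ-fromℕ< (m%n<n ℓ (List⁺.length S))))

  Hits⇒∈W : ∀ ℓ {i} → Located Ss i → Hits (f i) ℓ → i ∈ˢ W Ss ℓ
  Hits⇒∈W ℓ (S , S∈ , k , refl) hits = subst (λ k → lookup (toList S) k ∈ˢ W Ss ℓ)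
    (toℕ-injective (trans (toℕ-fromℕ< (m%n<n ℓ (List⁺.length S)))
      (subst (λ c → Hits c ℓ) (All.lookup fits S∈ k) hits)))
    (at-∈W ℓ S∈)

-- As j and j′ divide p, the hypothesis extends to all ℓ; its instances at q and q + j
-- show that j is a multiple of j′.
%-determines : ∀ {j q j′ q′ p} .{{_ : NonZero j}} .{{_ : NonZero j′}} .{{_ : NonZero p}} →
  q < j → j ∣ p → j′ ∣ p → (∀ {ℓ} → ℓ < p → ℓ % j ≡ q → ℓ % j′ ≡ q′) → j′ ∣ j × q % j′ ≡ q′
%-determines {j} {q} {j′} {q′} {p} q<j j∣p j′∣p h = j′∣j , q%j′≡q′
  where
  h∞ : ∀ ℓ → ℓ % j ≡ q → ℓ % j′ ≡ q′
  h∞ ℓ eq = trans (sym (m∣n⇒o%n%m≡o%m j′ p ℓ j′∣p))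
    (h (m%n<n ℓ p) (trans (m∣n⇒o%n%m≡o%m j p ℓ j∣p) eq))
  q%j′≡q′ : q % j′ ≡ q′
  q%j′≡q′ = h∞ q (m<n⇒m%n≡m q<j)
  [q+j]%j′≡q′ : (q + j) % j′ ≡ q′
  [q+j]%j′≡q′ = h∞ (q + j) (trans ([m+n]%n≡m%n q j) (m<n⇒m%n≡m q<j))
  open ≡-Reasoning
  j′∣j : j′ ∣ j
  j′∣j = ∣m+n∣m⇒∣n {m = (q ℕ./ j′) * j′} (subst (j′ ∣_) (sym quotients) (n∣m*n ((q + j) ℕ./ j′)))
    (n∣m*n (q ℕ./ j′))
    where
    -- Both `q` and `q + j` leave the remainder `q′`; cancelling it exhibits `j` as a difference of
    -- multiples of `j′`.
    quotients : (q ℕ./ j′) * j′ + j ≡ ((q + j) ℕ./ j′) * j′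
    quotients = +-cancelˡ-≡ q′ _ _ (begin
      q′ + ((q ℕ./ j′) * j′ + j)     ≡⟨ +-assoc q′ _ j ⟨
      q′ + (q ℕ./ j′) * j′ + j       ≡⟨ cong (λ r → r + (q ℕ./ j′) * j′ + j) q%j′≡q′ ⟨
      q % j′ + (q ℕ./ j′) * j′ + j   ≡⟨ cong (λ k → k + j) (m≡m%n+[m/n]*n q j′) ⟨
      q + j                          ≡⟨ m≡m%n+[m/n]*n (q + j) j′ ⟩
      (q + j) % j′ + ((q + j) ℕ./ j′) * j′ ≡⟨ cong (λ r → r + ((q + j) ℕ./ j′) * j′) [q+j]%j′≡q′ ⟩
      q′ + ((q + j) ℕ./ j′) * j′     ∎)

-- Equal sequences of blocks and equal colourings

module _ {n : ℕ} {f g : Fin n → Colour} {Ss Ts : List (List⁺ (Fin n))}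
  (fitsᶠ : All (Fits f) Ss) (fitsᵍ : All (Fits g) Ts)
  (locᶠ : ∀ i → Located Ss i) (locᵍ : ∀ i → Located Ts i) where

  -- Below the common period, the times at which `i` is updated form the class of `q` modulo `j` and
  -- also that of `q′` modulo `j′`. Each inclusion gives one divisibility between `j` and `j′`; then
  -- `q` and `q′` are remainders for the same modulus.
  W-≡⇒colour-≡ : period Ss ≡ period Ts → (∀ {ℓ} → ℓ < period Ss → W Ss ℓ ≡ W Ts ℓ) → f ≗ g
  W-≡⇒colour-≡ p≡ W≡ i
    with S , S∈ , k , Sk≡i ← locᶠ i | T , T∈ , l , Tl≡i ← locᵍ i =
    trans fi≡ (trans (cong₂ _,_ j≡j′ q≡q′) (sym gi≡))
    where
    j = List⁺.length S
    j′ = List⁺.length T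
    q = toℕ k
    q′ = toℕ l
    fi≡ : f i ≡ (j , q)
    fi≡ = trans (cong f (sym Sk≡i)) (All.lookup fitsᶠ S∈ k)
    gi≡ : g i ≡ (j′ , q′)
    gi≡ = trans (cong g (sym Tl≡i)) (All.lookup fitsᵍ T∈ l)
    j∣p : j ∣ period Ss
    j∣p = ∈⇒∣period S∈
    j′∣p : j′ ∣ period Ss
    j′∣p = subst (j′ ∣_) (sym p≡) (∈⇒∣period T∈)
    to : ∀ {ℓ} → ℓ < period Ss → ℓ % j ≡ q → ℓ % j′ ≡ q′
    to {ℓ} ℓ< eq = subst (λ c → Hits c ℓ) gi≡ (∈W⇒Hits fitsᵍ ℓ
      (subst (i ∈ˢ_) (W≡ ℓ<) (Hits⇒∈W fitsᶠ ℓ (locᶠ i) (subst (λ c → Hits c ℓ) (sym fi≡) eq))))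
    from : ∀ {ℓ} → ℓ < period Ss → ℓ % j′ ≡ q′ → ℓ % j ≡ q
    from {ℓ} ℓ< eq = subst (λ c → Hits c ℓ) fi≡ (∈W⇒Hits fitsᶠ ℓ
      (subst (i ∈ˢ_) (sym (W≡ ℓ<)) (Hits⇒∈W fitsᵍ ℓ (locᵍ i) (subst (λ c → Hits c ℓ) (sym gi≡) eq))))
    instance _ = period≢0 Ss
    j≡j′ : j ≡ j′
    j≡j′ = ∣-antisym (proj₁ (%-determines (toℕ<n l) j′∣p j∣p from))
      (proj₁ (%-determines (toℕ<n k) j∣p j′∣p to))
    q≡q′ : q ≡ q′
    q≡q′ = trans (sym (m<n⇒m%n≡m (subst (q <_) j≡j′ (toℕ<n k))))
      (proj₂ (%-determines (toℕ<n k) j∣p j′∣p to))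

  colour-≡⇒W-⊆ : f ≗ g → ∀ ℓ {i} → i ∈ˢ W Ss ℓ → i ∈ˢ W Ts ℓ
  colour-≡⇒W-⊆ f≗g ℓ {i} i∈ =
    Hits⇒∈W fitsᵍ ℓ (locᵍ i) (subst (λ c → Hits c ℓ) (f≗g i) (∈W⇒Hits fitsᶠ ℓ i∈))

  -- It suffices that every block length of `Ss` occurs in `Ts`. The head of a block serves as test
  -- entry: the block of `Ts` containing it has the length recorded in its colour.
  colour-≡⇒period-∣ : f ≗ g → period Ss ∣ period Ts
  colour-≡⇒period-∣ f≗g = period-least Ss λ {S} S∈ →
    let i = List⁺.head S
        T , T∈ , l , Tl≡i = locᵍ i
        same : (List⁺.length T , toℕ l) ≡ (List⁺.length S , 0)
        same = trans (sym (All.lookup fitsᵍ T∈ l)) (trans (cong g Tl≡i)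
          (trans (sym (f≗g i)) (All.lookup fitsᶠ S∈ zero)))
    in subst (_∣ period Ts) (proj₁ (,-injective same)) (∈⇒∣period T∈)

module _ {n : ℕ} where

  φ-≡⇒colour-≡ : ∀ {f g} {μ ν : BP n} →
    All (Fits f) (blocks μ) → All (Fits g) (blocks ν) → μ ≡₀ ν → f ≗ g
  φ-≡⇒colour-≡ {μ = μ} {ν} fitsᶠ fitsᵍ eq =
    let p≡ , W≡ = applyUpTo-injective _ _ (trans (sym (map-upTo _ _)) (trans eq (map-upTo _ _)))
    in W-≡⇒colour-≡ fitsᶠ fitsᵍ (locate ∘ covering μ) (locate ∘ covering ν) p≡ W≡

  colour-≡⇒φ-≡ : ∀ {f g} {μ ν : BP n} →
    All (Fits f) (blocks μ) → All (Fits g) (blocks ν) → f ≗ g → μ ≡₀ ν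
  colour-≡⇒φ-≡ {μ = μ} {ν} fitsᶠ fitsᵍ f≗g = trans
    (cong (map (W (blocks μ)) ∘ upTo) (∣-antisym
      (colour-≡⇒period-∣ fitsᶠ fitsᵍ locᵘ locᵛ f≗g)
      (colour-≡⇒period-∣ fitsᵍ fitsᶠ locᵛ locᵘ (sym ∘ f≗g))))
    (map-cong (λ ℓ → ⊆-antisym
      (colour-≡⇒W-⊆ fitsᶠ fitsᵍ locᵘ locᵛ f≗g ℓ)
      (colour-≡⇒W-⊆ fitsᵍ fitsᶠ locᵛ locᵘ (sym ∘ f≗g) ℓ)) _)
    where
    locᵘ = locate ∘ covering μ
    locᵛ = locate ∘ covering ν

  overlap⇒≡ : ∀ {Ss : List (List⁺ (Fin n))} {S T i} → AllPairs (Disjoint on toList) Ss →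
    S ∈ Ss → T ∈ Ss → i ∈ toList S → i ∈ toList T → S ≡ T
  overlap⇒≡ (_  ∷ _)  (here refl) (here refl) i∈S i∈T = refl
  overlap⇒≡ (S# ∷ _)  (here refl) (there T∈)  i∈S i∈T = contradiction (i∈S , i∈T) (All.lookup S# T∈)
  overlap⇒≡ (T# ∷ _)  (there S∈)  (here refl) i∈S i∈T = contradiction (i∈T , i∈S) (All.lookup T# S∈)
  overlap⇒≡ (_  ∷ Ss) (there S∈)  (there T∈)  i∈S i∈T = overlap⇒≡ Ss S∈ T∈ i∈S i∈T

  cell : ∀ {Ss i} → Located {n} Ss i → Colour
  cell (S , _ , k , _) = List⁺.length S , toℕ k

  colour : BP n → Fin n → Colour
  colour μ i = cell (locate (covering μ i))

  -- The witness from `covering` might point to another occurrence of the entry. Disjointness of the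
  -- o-blocks fixes the block, distinctness within it fixes the position.
  colour-fits : ∀ μ → All (Fits (colour μ)) (blocks μ)
  colour-fits μ = All.tabulate λ S∈ k → go S∈ k (locate (covering μ _))
    where
    go : ∀ {S} → S ∈ blocks μ → ∀ k (l : Located (blocks μ) (lookup (toList S) k)) →
         cell l ≡ (List⁺.length S , toℕ k)
    go {S} S∈ k (T , T∈ , l , Tl≡Sk)
      with refl ← overlap⇒≡ (disjoint μ) S∈ T∈ (∈-lookup k) (subst (_∈ toList T) Tl≡Sk (∈-lookup l)) =
      cong (λ k → List⁺.length S , toℕ k) (lookup-injective (All.lookup (distinct μ) S∈) l k Tl≡Sk)

  entries : List (List⁺ (Fin n)) → List (Fin n)
  entries = concatMap toList

  entries-unique : ∀ {Ss} →
    All (Unique ∘ toList) Ss → AllPairs (Disjoint on toList) Ss → Unique (entries Ss)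
  entries-unique Ss! Ss# = concat⁺ (All.map⁺ Ss!) (AllPairs.map⁺ Ss#)

  -- Both lists are free of repetitions and contain every index, so equality as sets is equality as
  -- bags.
  allFin-↭-entries : ∀ μ → allFin n ↭ entries (blocks μ)
  allFin-↭-entries μ = ∼bag⇒↭ (unique∧set⇒bag (allFin⁺ n) (entries-unique (distinct μ) (disjoint μ))
    (mk⇔ (λ _ → ∈-concatMap⁺ toList (covering μ _)) (λ _ → ∈-allFin _)))

  fits-entries : ∀ {f Ss} → All (Fits f) Ss →
    map f (entries Ss) ≡ concatMap positions (map List⁺.length Ss)
  fits-entries []                   = refl
  fits-entries {f} {S ∷ Ss} (S✓ ∷ Ss✓) = trans (map-++ f (toList S) (entries Ss))
    (cong₂ _++_ (map≡applyUpTo⁺ (List⁺.length S ,_) (toList S) S✓) (fits-entries Ss✓))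

  colours-↭ : ∀ μ → tabulate (colour μ) ↭ concatMap positions (map List⁺.length (blocks μ))
  colours-↭ μ = begin
    tabulate (colour μ)                                       ≡⟨ map-tabulate id (colour μ) ⟨
    map (colour μ) (allFin n)                                 ↭⟨ ↭.map⁺ (colour μ) (allFin-↭-entries μ) ⟩
    map (colour μ) (entries (blocks μ))                       ≡⟨ fits-entries (colour-fits μ) ⟩
    concatMap positions (map List⁺.length (blocks μ))         ∎
    where open PermutationReasoning

  shape : BP n → Partition n
  shape μ = record
    { parts         = sort lengths
    ; nonincreasing = sort-↗ lengths
    ; positive      = All-resp-↭ (↭-sym (sort-↭ lengths)) (All.map⁺ (All.universal (λ _ → z<s) (blocks μ)))
    ; sum≡n         = begin
        sum (sort lengths)           ≡⟨ sum-↭ (sort-↭ lengths) ⟩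
        sum lengths                  ≡⟨ go (blocks μ) ⟨
        length (entries (blocks μ))  ≡⟨ ↭-length (allFin-↭-entries μ) ⟨
        length (allFin n)            ≡⟨ length-tabulate id ⟩
        n                            ∎
    }
    where
    open Sort ≥-decTotalOrder
    open ≡-Reasoning
    lengths = map List⁺.length (blocks μ)
    go : ∀ Ss → length (entries Ss) ≡ sum (map List⁺.length Ss)
    go []       = refl
    go (S ∷ Ss) = trans (length-++ (toList S)) (cong (λ k → List⁺.length S + k) (go Ss))

  shape-↭ : ∀ μ → tabulate (colour μ) ↭ concatMap positions (parts (shape μ))
  shape-↭ μ = ↭-trans (colours-↭ μ) (concatMap-↭ positions (↭-sym (Sort.sort-↭ ≥-decTotalOrder _)))

  -- Modes with a prescribed colouring

  split : ∀ (f : Fin n → Colour) ps is → All (0 <_) ps → map f is ≡ concatMap positions ps →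
    ∃ λ Ss → entries Ss ≡ is × All (Fits f) Ss
  split f []           []       []         eq = [] , refl , []
  split f (suc j ∷ ps) is       (_ ∷ 0<ps) eq
    -- The indices that carry the first `suc j` colours, in this order, form the next block.
    with map-++⁻ f is (positions (suc j)) eq
  ... | x ∷ xs , zs , refl , eqˣ , eqᶻ
    with Ss , refl , fits ← split f ps zs 0<ps eqᶻ =
    (x List⁺.∷ xs) ∷ Ss , refl ,
    map≡applyUpTo⁻ (suc (length xs) ,_) (x ∷ xs) (trans eqˣ (cong positions (sym |xs|≡))) ∷ fits
    where
    |xs|≡ : length (x ∷ xs) ≡ suc j
    |xs|≡ = trans (sym (length-map f (x ∷ xs))) (trans (cong length eqˣ)
      (length-applyUpTo (suc j ,_) (suc j)))

  entries-unique⁻ : ∀ Ss → Unique (entries Ss) →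
    All (Unique ∘ toList) Ss × AllPairs (Disjoint on toList) Ss
  entries-unique⁻ []       _  = [] , []
  entries-unique⁻ (S ∷ Ss) u
    with S! , rest , S# ← Unique-++⁻ (toList S) u
    with Ss! , Ss# ← entries-unique⁻ Ss rest =
    S! ∷ Ss! , All.tabulate (λ T∈ (i∈S , i∈T) → S# (i∈S , ∈-concatMap⁺ toList (lose T∈ i∈T))) ∷ Ss#

  realise : ∀ (f : Fin n → Colour) ps → All (0 <_) ps → tabulate f ↭ concatMap positions ps →
    ∃ λ (μ : BP n) → All (Fits f) (blocks μ)
  realise f ps 0<ps p
    -- The permutation of colours is lifted along `f` to the indices. How equally coloured indices
    -- are ordered is arbitrary here, and `≡₀` does not see it.
    with is , eq , allFin↭ ← ↭-map-inv f (subst (_↭ concatMap positions ps) (sym (map-tabulate id f)) p)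
    with Ss , refl , fits ← split f ps is 0<ps (sym eq)
    with Ss! , Ss# ← entries-unique⁻ Ss
      (↭ₛ.Unique-resp-↭ (setoid (Fin n)) (↭⇒↭ₛ allFin↭) (allFin⁺ n)) = record
    { blocks   = Ss
    ; distinct = Ss!
    ; disjoint = Ss#
    ; covering = λ i → ∈-concatMap⁻ toList (∈-resp-↭ allFin↭ (∈-allFin i))
    } , fits

-- The cardinality of the quotient

length-positions : ∀ ps → length (concatMap positions ps) ≡ sum ps
length-positions []       = refl
length-positions (j ∷ ps) = trans (length-++ (positions j))
  (cong₂ _+_ (length-applyUpTo (j ,_) j) (length-positions ps))

length-concat-tabulate : ∀ {A : Set} N (f : Fin N → List A) →
  length (concat (tabulate f)) ≡ ∑< N (length ∘ f)
length-concat-tabulate zero    f = refl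
length-concat-tabulate (suc N) f = trans (length-++ (f zero))
  (cong (λ k → length (f zero) + k) (length-concat-tabulate N (f ∘ suc)))

as-tabulate : ∀ {A : Set} {k} (u : List A) → length u ≡ k → ∃ λ (f : Fin k → A) → tabulate f ≡ u
as-tabulate u refl = lookup u , tabulate-lookup u

module _ {A : Set} (S : Setoid 0ℓ 0ℓ) (f : Setoid.Carrier S → A) {xs : List A} where

  open Setoid S using (Carrier; _≈_)

  -- Here `f` is a complete invariant whose values are listed by `xs`. An element is sent to the
  -- index of its value; as `xs` has no repetition, this index does not depend on the membership
  -- proof.
  listing⇒cardinality : Unique xs → (∀ x → f x ∈ xs) →
    (∀ {x y} → x ≈ y → f x ≡ f y) → (∀ {x y} → f x ≡ f y → x ≈ y) →
    (∀ {a} → a ∈ xs → ∃ λ x → f x ≡ a) → HasCardinality S (length xs)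
  listing⇒cardinality xs! f∈ f-cong f-injective f-surjective = record
    { to        = to
    ; cong      = λ {x} {y} → to-cong x y
    ; bijective = (λ {x} {y} → to-injective x y) , to-surjective
    }
    where
    to : Carrier → Fin (length xs)
    to x = Any.index (f∈ x)
    lookup-to : ∀ x → lookup xs (to x) ≡ f x
    lookup-to x = sym (lookup-index (f∈ x))
    to-cong : ∀ x y → x ≈ y → to x ≡ to y
    to-cong x y x≈y = lookup-injective xs! (to x) (to y)
      (trans (lookup-to x) (trans (f-cong x≈y) (sym (lookup-to y))))
    to-injective : ∀ x y → to x ≡ to y → x ≈ y
    to-injective x y eq = f-injective
      (trans (sym (lookup-to x)) (trans (cong (lookup xs) eq) (lookup-to y)))
    to-surjective : ∀ k → ∃ λ x → ∀ {y} → y ≈ x → to y ≡ k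
    to-surjective k with x , eq ← f-surjective (∈-lookup k) = x , λ {y} y≈x →
      trans (to-cong y x y≈x) (lookup-injective xs! (to x) k (trans (lookup-to x) eq))

module _ (n : ℕ) where

  slotsOf : Fin (p n) → List (Colour × ℕ)
  slotsOf i = slots (d n i) (m n i)

  colourings : List (List Colour)
  colourings = concat (tabulate (arrangements ∘ slotsOf))

  ∈-arrangements⇒↭ : ∀ i {u} → u ∈ arrangements (slotsOf i) →
    u ↭ concatMap positions (parts (partition n i))
  ∈-arrangements⇒↭ i u∈ = ↭-trans (arrangements-↭ (slotsOf i) u∈) (slots-↭ n i)

  -- A colouring listed for two partitions would be a permutation of the colours of both, and these
  -- determine the partition.
  colourings-unique : Unique colourings
  colourings-unique = concat⁺
    (All.tabulate⁺ λ i → arrangements-unique _≟ᶜ_ (slotsOf i) (slots-unique (d n i) (m n i)))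
    (AllPairs.tabulate⁺ λ {i} {j} i≢j (u∈ , u∈′) → i≢j (Bijection.injective (partition-bijection n)
      (positions-injective (partition n i) (partition n j)
        (↭-trans (↭-sym (∈-arrangements⇒↭ i u∈)) (∈-arrangements⇒↭ j u∈′)))))

  colour-∈ : ∀ μ → tabulate (colour μ) ∈ colourings
  colour-∈ μ with i , eq ← Bijection.strictlySurjective (partition-bijection n) (shape μ) =
    ∈-concat⁺′
      (∈-arrangements _≟ᶜ_ (slotsOf i) (slots-unique (d n i) (m n i)) (↭-trans (shape-↭ μ)
        (subst (λ π → concatMap positions (parts π) ↭ expand (slotsOf i)) eq (↭-sym (slots-↭ n i)))))
      (∈-tabulate⁺ i)

  ∈-colourings⇒colour : ∀ {u} → u ∈ colourings → ∃ λ μ → tabulate (colour μ) ≡ u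
  ∈-colourings⇒colour {u} u∈
    with _ , u∈i , i∈ ← ∈-concat⁻′ (tabulate (arrangements ∘ slotsOf)) u∈
    with i , refl ← ∈-tabulate⁻ i∈
    with f , refl ← as-tabulate u (trans (↭-length (∈-arrangements⇒↭ i u∈i))
      (trans (length-positions (parts (partition n i))) (sum≡n (partition n i))))
    with μ , fits ← realise f (parts (partition n i)) (positive (partition n i)) (∈-arrangements⇒↭ i u∈i) =
    -- The mode was built to fit `f`, whereas the goal speaks of `colour μ`; since the blocks cover
    -- all indices, only one colouring fits them.
    μ , tabulate-cong (fits-unique (colour-fits μ) fits (locate ∘ covering μ))

  BP⁰-cardinality : HasCardinality (BP⁰ n) (length colourings)
  BP⁰-cardinality = listing⇒cardinality (BP⁰ n) (λ μ → tabulate (colour μ)) colourings-unique colour-∈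
    (λ {μ} {ν} → tabulate-cong ∘ φ-≡⇒colour-≡ {μ = μ} {ν} (colour-fits μ) (colour-fits ν))
    (λ {μ} {ν} → colour-≡⇒φ-≡ {μ = μ} {ν} (colour-fits μ) (colour-fits ν) ∘ tabulate-injective)
    ∈-colourings⇒colour

  -- Both sides are the length of the list of colours, counted by colour and by block.
  sum-multiplicities : ∀ i → sum (multiplicities (d n i) (m n i)) ≡ n
  sum-multiplicities i = begin
    sum (multiplicities (d n i) (m n i))                    ≡⟨ cong sum (slots-multiplicities (d n i) (m n i)) ⟨
    sum (map proj₂ (slotsOf i))                             ≡⟨ length-expand (slotsOf i) ⟨
    length (expand (slotsOf i))                             ≡⟨ ↭-length (slots-↭ n i) ⟩
    length (concatMap positions (parts (partition n i)))    ≡⟨ length-positions (parts (partition n i)) ⟩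
    sum (parts (partition n i))                             ≡⟨ sum≡n (partition n i) ⟩
    n                                                       ∎
    where open ≡-Reasoning

  length-colourings : length colourings ≡ ∑[ i < p n ] binomials n (multiplicities (d n i) (m n i))
  length-colourings = trans (length-concat-tabulate (p n) (arrangements ∘ slotsOf))
    (ℕ-∑.sum-cong-≗ {p n} λ i → begin
      length (arrangements (slotsOf i))
        ≡⟨ length-arrangements (slotsOf i) ⟩
      binomials (sum (map proj₂ (slotsOf i))) (map proj₂ (slotsOf i))
        ≡⟨ cong (λ ms → binomials (sum ms) ms) (slots-multiplicities (d n i) (m n i)) ⟩
      binomials (sum (multiplicities (d n i) (m n i))) (multiplicities (d n i) (m n i))
        ≡⟨ cong (λ r → binomials r (multiplicities (d n i) (m n i))) (sum-multiplicities i) ⟩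
      binomials n (multiplicities (d n i) (m n i)) ∎)
    where open ≡-Reasoning

  binomials-quotient : ∀ i →
    binomials n (multiplicities (d n i) (m n i)) * (∏[ j =1… d n i ] (m n i j !) ^ j) ≡ n !
  binomials-quotient i = begin
    binomials n ms * (∏[ j =1… d n i ] (m n i j !) ^ j)
      ≡⟨ cong₂ (λ r x → binomials r ms * x) (sum-multiplicities i)
           (product-!-multiplicities (d n i) (m n i)) ⟨
    binomials (sum ms) ms * product (map _! ms)
      ≡⟨ binomials-factorial ms ⟩
    (sum ms) !
      ≡⟨ cong _! (sum-multiplicities i) ⟩
    n ! ∎
    where
    open ≡-Reasoning
    ms = multiplicities (d n i) (m n i)

theorem2 : (n : ℕ) → n ≥ 1 →
    ∃ λ N → HasCardinality (BP⁰ n) N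
    × (+ N / 1 ≡
        ∑ℚ[ i < p n ]
          _/_ (+ (n !)) (∏[ j =1… d n i ] (m n i j !) ^ j)
              {{∏₁-nonZero (d n i) (m!^≢0 n i)}})
    × (N ≡
        ∑[ i < p n ] ∏[ j =1… d n i ] ∏[ ℓ =1… j ]
          (n ∸ (∑[ k =1… j ∸ 1 ] k * m n i k) ∸ (ℓ ∸ 1) * m n i j) C (m n i j))
    × (N ≡
        ∑[ i < p n ] ∏[ j =1… d n i ]
          ((n ∸ (∑[ k =1… j ∸ 1 ] k * m n i k)) C (j * m n i j))
          * (∏[ ℓ =1… j ] ((j ∸ ℓ + 1) * m n i j) C (m n i j)))
theorem2 n _ =
  length (colourings n) , BP⁰-cardinality n
  , trans (cong (λ N → + N / 1) (length-colourings n))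
      -- Every summand is a natural number, so the rational sum can be compared term by term with
      -- the natural one.
      (trans (/1-homo-∑ (p n) a) (ℚ-∑.sum-cong-≗ {p n} λ i →
        /1-quotient (a i) (∏[ j =1… d n i ] (m n i j !) ^ j) (n !) {{∏₁-nonZero (d n i) (m!^≢0 n i)}}
          (binomials-quotient n i)))
  , trans (length-colourings n) (ℕ-∑.sum-cong-≗ {p n} λ i → binomials-multiplicities (d n i) (m n i) n)
  , trans (length-colourings n) (ℕ-∑.sum-cong-≗ {p n} λ i → binomials-multiplicities′ (d n i) (m n i) n)
  where
  a : Fin (p n) → ℕ
  a i = binomials n (multiplicities (d n i) (m n i))
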